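{- Let $n\ge1$, $\mathcal{M}=\{1^{k_1},\ldots,n^{k_n}\}$ with all $k_i\ge1$, and $K=k_1+\cdots+k_n$. For every integer $m\ge0$, $$|\mathcal{BT}_{\mathcal{M},m}|=\frac{m^n}{K-n+1}\binom{K-n+m}{m}.$$
   Context: $\mathcal{M}$ is the multiset in which $i$ occurs exactly $k_i$ times. An ordered tree is a rooted tree whose children at each vertex are linearly ordered left to right; the level of a vertex is its distance from the root. $\mathcal{BT}_{\mathcal{M},m}$ is the set of ordered trees such that: (i) vertices are labeled by the multiset $\{0\}\cup\mathcal{M}$ (each label used exactly as often as its multiplicity), except that some leaves at odd level may be unlabeled; (ii) the root is labeled $0$; (iii) each labeled odd-level vertex with label $i$ has exactly $k_i-1$ children, all labeled $i$; (iv) for each internal vertex $v$ at even level, the sequence of children of $v$ is divided into consecutive blocks, each block being either a single unlabeled leaf or a nonempty set of labeled children whose labels increase from left to right; and the total number of blocks (over all even-level internal vertices) is $m$. Trees are counted up to label-and-block-preserving isomorphism of ordered trees. -}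

module Defs where

open import Data.Nat using (ℕ; zero; suc; _+_; _∸_; _≡ᵇ_; _<ᵇ_; _≤ᵇ_)
open import Data.Nat.Properties using (_<?_)
open import Data.Bool using (Bool; true; false; _∧_; T; if_then_else_)
open import Data.List using (List; []; _∷_; _++_; length; map; upTo; tabulate)
open import Data.Nat.ListAction using (sum)
open import Data.Fin using (Fin; fromℕ<)
open import Data.Product using (Σ)
open import Relation.Nullary using (yes; no)

-- Ordered trees of BT_{M,m}, as concrete data (ordered trees up to
-- label-and-block-preserving isomorphism = equal data).
mutual
  -- vertex at even level: its label and the list of blocks into which its
  -- (ordered) children are divided; a leaf has no blocks.
  data ETree : Set where
    enode : ℕ → List Block → ETree

  data Block : Set where
    leafBlock : Block               -- a single unlabeled (odd-level) leaf
    labBlock  : List OTree → Block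

  -- labeled vertex at odd level: its label and its (even-level) children
  data OTree : Set where
    onode : ℕ → List ETree → OTree

elabel : ETree → ℕ
elabel (enode l _) = l

olabel : OTree → ℕ
olabel (onode l _) = l

-- multiset {0} ∪ M: multiplicity of label j (label i ∈ {1..n} has k (i-1))
mult : (n : ℕ) → (Fin n → ℕ) → ℕ → ℕ
mult n k zero = 1
mult n k (suc j) with j <? n
... | yes p = k (fromℕ< p)
... | no _  = 0

Ksum : (n : ℕ) → (Fin n → ℕ) → ℕ
Ksum n k = sum (tabulate k)

mutual
  labelsE : ETree → List ℕ
  labelsE (enode l bs) = l ∷ labelsBs bs

  labelsBs : List Block → List ℕ
  labelsBs [] = []
  labelsBs (b ∷ bs) = labelsB b ++ labelsBs bs

  labelsB : Block → List ℕ
  labelsB leafBlock = []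
  labelsB (labBlock os) = labelsOs os

  labelsOs : List OTree → List ℕ
  labelsOs [] = []
  labelsOs (o ∷ os) = labelsO o ++ labelsOs os

  labelsO : OTree → List ℕ
  labelsO (onode i es) = i ∷ labelsEs es

  labelsEs : List ETree → List ℕ
  labelsEs [] = []
  labelsEs (e ∷ es) = labelsE e ++ labelsEs es

mutual
  blocksE : ETree → ℕ
  blocksE (enode l bs) = length bs + blocksBs bs

  blocksBs : List Block → ℕ
  blocksBs [] = 0
  blocksBs (b ∷ bs) = blocksB b + blocksBs bs

  blocksB : Block → ℕ
  blocksB leafBlock = 0
  blocksB (labBlock os) = blocksOs os

  blocksOs : List OTree → ℕ
  blocksOs [] = 0
  blocksOs (o ∷ os) = blocksO o + blocksOs os

  blocksO : OTree → ℕ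
  blocksO (onode i es) = blocksEs es

  blocksEs : List ETree → ℕ
  blocksEs [] = 0
  blocksEs (e ∷ es) = blocksE e + blocksEs es

allB : {A : Set} → (A → Bool) → List A → Bool
allB p [] = true
allB p (x ∷ xs) = p x ∧ allB p xs

nonempty : {A : Set} → List A → Bool
nonempty [] = false
nonempty (_ ∷ _) = true

increasing : List ℕ → Bool
increasing [] = true
increasing (x ∷ []) = true
increasing (x ∷ y ∷ r) = (x <ᵇ y) ∧ increasing (y ∷ r)

module _ (n : ℕ) (k : Fin n → ℕ) where
  mutual
    okE : ETree → Bool
    okE (enode l bs) = okBs bs

    okBs : List Block → Bool
    okBs [] = true
    okBs (b ∷ bs) = okB b ∧ okBs bs

    okB : Block → Bool
    okB leafBlock = true
    okB (labBlock os) = nonempty os ∧ increasing (map olabel os) ∧ okOs os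

    okOs : List OTree → Bool
    okOs [] = true
    okOs (o ∷ os) = okO o ∧ okOs os

    okO : OTree → Bool
    okO (onode i es) =
      (length es ≡ᵇ (mult n k i ∸ 1)) ∧ allB (λ e → elabel e ≡ᵇ i) es ∧ okEs es

    okEs : List ETree → Bool
    okEs [] = true
    okEs (e ∷ es) = okE e ∧ okEs es

count : ℕ → List ℕ → ℕ
count j [] = 0
count j (x ∷ xs) = (if j ≡ᵇ x then 1 else 0) + count j xs

labelsOK : (n : ℕ) → (Fin n → ℕ) → List ℕ → Bool
labelsOK n k ls =
  allB (λ l → l ≤ᵇ n) ls ∧ allB (λ j → count j ls ≡ᵇ mult n k j) (upTo (suc n))

valid : (n : ℕ) → (Fin n → ℕ) → ℕ → ETree → Bool
valid n k m t =
  (elabel t ≡ᵇ 0) ∧ okE n k t ∧ labelsOK n k (labelsE t) ∧ (blocksE t ≡ᵇ m)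

BT : (n : ℕ) → (Fin n → ℕ) → ℕ → Set
BT n k m = Σ ETree (λ t → T (valid n k m t))

{-# OPTIONS --safe #-}
module Submission where

-- Only one odd-level vertex carries the label i, and its children use up the
-- other k_i - 1 copies; so a tree is governed by the set S of labels of its
-- odd-level vertices. Generalise to forests of p even-level roots with m blocks.
-- If d_i = k_i - 1 and d(A) sums d_i over A, looking at the first root gives
--   F(m+1, p+1, S) = F(m+1, p, S) + sum over A of F(m, d(A) + p + 1, S - A):
-- either the root is a leaf and is dropped, or its first block has label set A
-- (A empty for an unlabeled leaf), and we remove that block and put the d(A)
-- grandchildren below it in front as new roots. The quantity q = p + 1 + d(S) is
-- the same throughout the sum, which lets induction prove
--   q F(m, p+1, S) = (p+1) m^|S| binom(m+q-1, m).
-- The theorem is the case of a single root and S = {1..n}.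

open import Defs
open import Data.Bool using (Bool; T; if_then_else_)
open import Data.Bool.Properties using (T-∧; T-irrelevant)
open import Data.Empty using (⊥; ⊥-elim)
open import Data.Fin using (Fin; zero; suc; toℕ; fromℕ<; splitAt; join)
open import Data.Fin.Properties using (splitAt-join; join-splitAt; toℕ<n; fromℕ<-toℕ; toℕ-fromℕ<)
open import Data.List using (List; []; _∷_; _++_; length; map; take; drop; tabulate; upTo)
open import Data.List.Membership.Propositional using (_∈_)
open import Data.List.Membership.Propositional.Properties using (∈-tabulate⁺; ∈-upTo⁺; ∈-upTo⁻)
open import Data.List.Properties
  using (length-map; length-++; length-tabulate; length-take; length-drop; ++-assoc; ++-identityʳ;
         ∷-injectiveʳ; take++drop≡id; drop-drop; map-tabulate)
open import Data.List.Relation.Ternary.Interleaving.Propositional using (Interleaving; []; consˡ; consʳ)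
open import Data.List.Relation.Unary.All as All using (All; []; _∷_)
open import Data.List.Relation.Unary.All.Properties as All using (++⁺; ++⁻)
open import Data.List.Relation.Unary.AllPairs using (AllPairs; []; _∷_)
open import Data.List.Relation.Unary.AllPairs.Properties using (tabulate⁺-<)
open import Data.List.Relation.Unary.Any using (here; there)
open import Data.Nat
open import Data.Nat.Combinatorics using (_C_; nC1≡n; nCk+nC[k+1]≡[n+1]C[k+1])
open import Data.Nat.Combinatorics.Specification using (k>n⇒nCk≡0)
open import Data.Nat.ListAction using (sum)
open import Data.Nat.Properties
open import Data.Nat.Tactic.RingSolver using (solve-∀)
open import Data.Product using (Σ; Σ-syntax; ∃; ∃₂; _×_; _,_; proj₁; proj₂)
open import Data.Sum as Sum using (_⊎_; inj₁; inj₂; [_,_]′)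
open import Data.Unit using (⊤)
open import Function using (_∘_; id; Equivalence)
open import Function.Bundles using (_↔_; mk↔ₛ′)
open import Relation.Binary using (tri<; tri≈; tri>)
open import Relation.Binary.PropositionalEquality
open import Relation.Nullary using (¬_; yes; no; contradiction)
open import Relation.Unary using (Irrelevant)

open ≡-Reasoning

-- Binomial ratios and sums over subsets.

C-suc : ∀ m e → suc m * ((m + e) C suc m) ≡ e * ((m + e) C m)
C-suc m zero = begin
  suc m * ((m + 0) C suc m) ≡⟨ cong (suc m *_) (k>n⇒nCk≡0 (s≤s (≤-reflexive (+-identityʳ m)))) ⟩
  suc m * 0                 ≡⟨ *-zeroʳ m ⟩
  0                         ∎
C-suc zero (suc e) = begin
  1 * (suc e C 1) ≡⟨ cong (1 *_) (nC1≡n (suc e)) ⟩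
  1 * suc e       ≡⟨ *-comm 1 (suc e) ⟩
  suc e * 1       ∎
-- Pascal's rule gives two binomials over the same N. Read as `m + suc e` and as `suc m + e`, N fits
-- two smaller instances of the identity.
C-suc (suc m) (suc e) = begin
  (2 + m) * (suc N C (2 + m))                         ≡⟨ cong ((2 + m) *_) (nCk+nC[k+1]≡[n+1]C[k+1] N (suc m)) ⟨
  (2 + m) * (b + (N C (2 + m)))                       ≡⟨ *-distribˡ-+ (2 + m) b _ ⟩
  (2 + m) * b + (2 + m) * (N C (2 + m))               ≡⟨ cong ((2 + m) * b +_) upper ⟩
  b + suc m * b + e * b                               ≡⟨ cong (λ x → b + x + e * b) (C-suc m (suc e)) ⟩
  b + suc e * a + e * b                               ≡⟨ collect a b e ⟩
  suc e * (a + b)                                     ≡⟨ cong (suc e *_) (nCk+nC[k+1]≡[n+1]C[k+1] N m) ⟩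
  suc e * (suc N C suc m)                             ∎
  where
  N = m + suc e
  a = N C m
  b = N C suc m
  collect : ∀ a b e → b + suc e * a + e * b ≡ suc e * (a + b)
  collect = solve-∀
  upper : (2 + m) * (N C (2 + m)) ≡ e * b
  upper = subst (λ x → (2 + m) * (x C (2 + m)) ≡ e * (x C suc m)) (sym (+-suc m e)) (C-suc (suc m) e)

-- The sum over subsets A of S in the recurrence. Sets are stored as lists, and the complementary
-- sublists `a` and `r` stand for A and S - A.
splitSum : List ℕ → (List ℕ → List ℕ → ℕ) → ℕ
splitSum []      g = g [] []
splitSum (x ∷ S) g = splitSum S (λ a r → g (x ∷ a) r) + splitSum S (λ a r → g a (x ∷ r))

-- Agreement is asked only on interleavings, since the summands met later agree only because
-- `total a + total r` equals `total S`.
splitSum-cong : ∀ S {g h} → (∀ {a r} → Interleaving a r S → g a r ≡ h a r) →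
                splitSum S g ≡ splitSum S h
splitSum-cong []      eq = eq []
splitSum-cong (x ∷ S) eq =
  cong₂ _+_ (splitSum-cong S (λ s → eq (consˡ s))) (splitSum-cong S (λ s → eq (consʳ s)))

splitSum-*ˡ : ∀ S c {g} → splitSum S (λ a r → c * g a r) ≡ c * splitSum S g
splitSum-*ˡ []      c     = refl
splitSum-*ˡ (x ∷ S) c {g} =
  trans (cong₂ _+_ (splitSum-*ˡ S c) (splitSum-*ˡ S c)) (sym (*-distribˡ-+ c (splitSum S (λ a r → g (x ∷ a) r)) _))

-- The recurrence and its closed form.

module _ (d : ℕ → ℕ) where

  total : List ℕ → ℕ
  total S = sum (map d S)

  total-split : ∀ {a r S} → Interleaving a r S → total a + total r ≡ total S
  total-split []                 = refl
  total-split {x ∷ a} {r} (consˡ s) = trans (+-assoc (d x) _ _) (cong (d x +_) (total-split s))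
  total-split {a} {x ∷ r} (consʳ s) = begin
    total a + (d x + total r) ≡⟨ swap (total a) (d x) (total r) ⟩
    d x + (total a + total r) ≡⟨ cong (d x +_) (total-split s) ⟩
    _ ∎
    where
    swap : ∀ p q r → p + (q + r) ≡ q + (p + r)
    swap = solve-∀

  -- Weighting A by m^|S - A| gives total weight (m+1)^|S|, and the sets containing a fixed x have
  -- weight (m+1)^(|S|-1). The factor `suc m` avoids that exponent. The constant `c` is general
  -- because an element put into A adds its `d x` to it; an element left out contributes a factor m.
  splitSum-weighted : ∀ m c S →
    suc m * splitSum S (λ a r → (total a + c) * m ^ length r)
      ≡ (total S + c * suc m) * suc m ^ length S
  splitSum-weighted m c [] = base m c
    where
    base : ∀ m c → suc m * (c * 1) ≡ c * suc m * 1
    base = solve-∀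
  splitSum-weighted m c (x ∷ S) = begin
    suc m * (splitSum S (λ a r → (d x + total a + c) * m ^ length r)
             + splitSum S (λ a r → (total a + c) * (m * m ^ length r)))
      ≡⟨ cong (suc m *_) (cong₂ _+_
           (splitSum-cong S (λ {a} {r} _ → cong (_* m ^ length r) (shift (d x) (total a) c)))
           (trans (splitSum-cong S (λ {a} {r} _ → pull (total a + c) m (m ^ length r))) (splitSum-*ˡ S m))) ⟩
    suc m * (u + m * v)         ≡⟨ dist (suc m) u m v ⟩
    suc m * u + m * (suc m * v) ≡⟨ cong₂ (λ x y → x + m * y) (splitSum-weighted m (d x + c) S) (splitSum-weighted m c S) ⟩
    (total S + (d x + c) * suc m) * w + m * ((total S + c * suc m) * w)
      ≡⟨ collect (d x) (total S) c m w ⟩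
    (d x + total S + c * suc m) * (suc m * w) ∎
    where
    u = splitSum S (λ a r → (total a + (d x + c)) * m ^ length r)
    v = splitSum S (λ a r → (total a + c) * m ^ length r)
    w = suc m ^ length S
    shift : ∀ p q r → p + q + r ≡ q + (p + r)
    shift = solve-∀
    pull : ∀ p q r → p * (q * r) ≡ q * (p * r)
    pull = solve-∀
    dist : ∀ s u m v → s * (u + m * v) ≡ s * u + m * (s * v)
    dist = solve-∀
    collect : ∀ x t c m w → (t + (x + c) * suc m) * w + m * ((t + c * suc m) * w)
                            ≡ (x + t + c * suc m) * (suc m * w)
    collect = solve-∀

  -- The F(m, p, S) of the recurrence. Without blocks all roots are leaves and are dropped one by
  -- one. Recursion goes by m first, because removing a block may increase the number of roots.
  forests : ℕ → ℕ → List ℕ → ℕ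
  forests zero    zero    []      = 1
  forests zero    zero    (_ ∷ _) = 0
  forests (suc m) zero    S       = 0
  forests zero    (suc p) S       = forests zero p S
  forests (suc m) (suc p) S       =
    forests (suc m) p S + splitSum S (λ a r → forests m (total a + suc p) r)

  Formula : ℕ → ℕ → List ℕ → Set
  Formula m p S = forests m (suc p) S * (suc p + total S)
                  ≡ suc p * (m ^ length S * ((m + (p + total S)) C m))

  private
    combine : ∀ m D W p F → (p ≡ 0 → F ≡ 0) → F * (p + D) ≡ p * (W * ((m + (p + D)) C suc m)) →
              F * (suc p + D) * suc m + ((m + (p + D)) C m) * ((D + suc p * suc m) * W)
              ≡ suc p * (W * (((m + (p + D)) C m) + ((m + (p + D)) C suc m))) * suc m
    -- For p = 0 the hypothesis on F is void when D = 0, so F ≡ 0 is supplied separately.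
    combine m D W zero F F≡0 _ = begin
      F * suc D * suc m + c₀ * ((D + 1 * suc m) * W) ≡⟨ cong (λ x → x * suc D * suc m + c₀ * ((D + 1 * suc m) * W)) (F≡0 refl) ⟩
      c₀ * ((D + 1 * suc m) * W)                ≡⟨ left c₀ D m W ⟩
      W * (c₀ * suc m + D * c₀)                 ≡⟨ cong (λ x → W * (c₀ * suc m + x)) (C-suc m D) ⟨
      W * (c₀ * suc m + suc m * c₁)             ≡⟨ right c₀ c₁ m W ⟩
      1 * (W * (c₀ + c₁)) * suc m               ∎
      where
      c₀ = (m + D) C m
      c₁ = (m + D) C suc m
      left : ∀ c D m W → c * ((D + 1 * suc m) * W) ≡ W * (c * suc m + D * c)
      left = solve-∀
      right : ∀ c c′ m W → W * (c * suc m + suc m * c′) ≡ 1 * (W * (c + c′)) * suc m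
      right = solve-∀
    -- The factor e = p + 1 + D is positive, so it may be multiplied in and cancelled at the end. It
    -- turns F into `F * e`, which `hyp` evaluates; `C-suc` then trades c₁ for c₀ and back.
    combine m D W (suc p) F _ hyp = *-cancelʳ-≡ _ _ e (begin
      (F * suc e * suc m + c₀ * ((D + suc (suc p) * suc m) * W)) * e
        ≡⟨ expand F e m c₀ ((D + suc (suc p) * suc m) * W) ⟩
      F * e * (suc e * suc m) + c₀ * ((D + suc (suc p) * suc m) * W) * e
        ≡⟨ cong (λ x → x * (suc e * suc m) + c₀ * ((D + suc (suc p) * suc m) * W) * e) hyp ⟩
      suc p * (W * c₁) * (suc e * suc m) + c₀ * ((D + suc (suc p) * suc m) * W) * e
        ≡⟨ pull p W c₁ e m (c₀ * ((D + suc (suc p) * suc m) * W) * e) ⟩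
      suc p * W * suc e * (suc m * c₁) + c₀ * ((D + suc (suc p) * suc m) * W) * e
        ≡⟨ cong (λ x → suc p * W * suc e * x + c₀ * ((D + suc (suc p) * suc m) * W) * e) (C-suc m e) ⟩
      suc p * W * suc e * (e * c₀) + c₀ * ((D + suc (suc p) * suc m) * W) * e
        ≡⟨ main m c₀ D p W ⟩
      suc (suc p) * W * (c₀ * suc m + e * c₀) * e
        ≡⟨ cong (λ x → suc (suc p) * W * (c₀ * suc m + x) * e) (C-suc m e) ⟨
      suc (suc p) * W * (c₀ * suc m + suc m * c₁) * e
        ≡⟨ right c₀ c₁ m p W e ⟩
      suc (suc p) * (W * (c₀ + c₁)) * suc m * e ∎)
      where
      e = suc p + D
      c₀ = (m + e) C m
      c₁ = (m + e) C suc m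
      expand : ∀ F e m c x → (F * suc e * suc m + c * x) * e ≡ F * e * (suc e * suc m) + c * x * e
      expand = solve-∀
      pull : ∀ p W c e m x → suc p * (W * c) * (suc e * suc m) + x ≡ suc p * W * suc e * (suc m * c) + x
      pull = solve-∀
      main : ∀ m c D p W →
        suc p * W * suc (suc p + D) * ((suc p + D) * c) + c * ((D + suc (suc p) * suc m) * W) * (suc p + D)
        ≡ suc (suc p) * W * (c * suc m + (suc p + D) * c) * (suc p + D)
      main = solve-∀
      right : ∀ c c′ m p W e → suc (suc p) * W * (c * suc m + suc m * c′) * e
            ≡ suc (suc p) * (W * (c + c′)) * suc m * e
      right = solve-∀

    -- All summands share q, so induction gives each the same binomial c₀, and `splitSum-weighted`
    -- evaluates what remains, at the cost of a factor `suc m` that is cancelled. The term with one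
    -- root fewer enters as a hypothesis in a form that also makes sense for p = 0, where `Formula`
    -- says nothing.
    formula-step : ∀ m p S → (∀ p r → Formula m p r) →
      (p ≡ 0 → forests (suc m) p S ≡ 0) →
      forests (suc m) p S * (p + total S) ≡ p * (suc m ^ length S * ((m + (p + total S)) C suc m)) →
      Formula (suc m) p S
    formula-step m p S ih F≡0 F-formula = *-cancelʳ-≡ _ _ (suc m) (begin
      (F + B) * q * suc m                               ≡⟨ expand F B q (suc m) ⟩
      F * q * suc m + B * q * suc m                     ≡⟨ cong (F * q * suc m +_) B-formula ⟩
      F * q * suc m + c₀ * ((D + suc p * suc m) * W)    ≡⟨ combine m D W p F F≡0 F-formula ⟩
      suc p * (W * (c₀ + ((m + (p + D)) C suc m))) * suc m
        ≡⟨ cong (λ x → suc p * (W * x) * suc m) (nCk+nC[k+1]≡[n+1]C[k+1] (m + (p + D)) m) ⟩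
      suc p * (W * ((suc m + (p + D)) C suc m)) * suc m ∎)
      where
      D = total S
      q = suc p + D
      W = suc m ^ length S
      F = forests (suc m) p S
      B = splitSum S (λ a r → forests m (total a + suc p) r)
      U = splitSum S (λ a r → (total a + suc p) * m ^ length r)
      c₀ = (m + (p + D)) C m

      expand : ∀ f s q m → (f + s) * q * m ≡ f * q * m + s * q * m
      expand = solve-∀

      term : ∀ {a r} → Interleaving a r S →
             q * forests m (total a + suc p) r ≡ c₀ * ((total a + suc p) * m ^ length r)
      term {a} {r} s = begin
        q * forests m (total a + suc p) r
          ≡⟨ cong₂ (λ x y → x * forests m y r) (sym size) (+-suc (total a) p) ⟩
        (suc (total a + p) + total r) * forests m (suc (total a + p)) r
          ≡⟨ *-comm (suc (total a + p) + total r) _ ⟩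
        forests m (suc (total a + p)) r * (suc (total a + p) + total r)
          ≡⟨ ih (total a + p) r ⟩
        suc (total a + p) * (m ^ length r * ((m + (total a + p + total r)) C m))
          ≡⟨ cong₂ (λ x y → x * (m ^ length r * ((m + y) C m))) (sym (+-suc (total a) p)) (suc-injective size) ⟩
        (total a + suc p) * (m ^ length r * c₀)
          ≡⟨ rotate (total a + suc p) (m ^ length r) c₀ ⟩
        c₀ * ((total a + suc p) * m ^ length r) ∎
        where
        regroup : ∀ x p y → suc (x + p) + y ≡ suc p + (x + y)
        regroup = solve-∀
        -- The weight d(A) leaves the sum over labels and reappears as the number of new roots, so q
        -- does not change.
        size : suc (total a + p) + total r ≡ q
        size = trans (regroup (total a) p (total r)) (cong (suc p +_) (total-split s))
        rotate : ∀ x y z → x * (y * z) ≡ z * (x * y)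
        rotate = solve-∀

      B-formula : B * q * suc m ≡ c₀ * ((D + suc p * suc m) * W)
      B-formula = begin
        B * q * suc m    ≡⟨ cong (_* suc m) (*-comm B q) ⟩
        q * B * suc m    ≡⟨ cong (_* suc m) (splitSum-*ˡ S q) ⟨
        splitSum S (λ a r → q * forests m (total a + suc p) r) * suc m
                         ≡⟨ cong (_* suc m) (trans (splitSum-cong S term) (splitSum-*ˡ S c₀)) ⟩
        c₀ * U * suc m   ≡⟨ trans (*-assoc c₀ U (suc m)) (cong (c₀ *_) (*-comm U (suc m))) ⟩
        c₀ * (suc m * U) ≡⟨ cong (c₀ *_) (splitSum-weighted m (suc p) S) ⟩
        c₀ * ((D + suc p * suc m) * W) ∎

  -- Induction on m, then on p. At m = 0 the power `zero ^ length S` is 1 or 0 according to whether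
  -- S is empty, as the count requires. For a single root the term with one root fewer is 0 by
  -- definition.
  forests-formula : ∀ m p S → Formula m p S
  forests-formula zero p [] = trans (cong (_* (suc p + 0)) (one p)) (base p)
    where
    base : ∀ p → 1 * (suc p + 0) ≡ suc p * (1 * 1)
    base = solve-∀
    one : ∀ p → forests zero p [] ≡ 1
    one zero    = refl
    one (suc p) = one p
  forests-formula zero p (x ∷ S) = trans (cong (_* (suc p + total (x ∷ S))) (none p)) (sym (*-zeroʳ p))
    where
    none : ∀ p → forests zero p (x ∷ S) ≡ 0
    none zero    = refl
    none (suc p) = none p
  forests-formula (suc m) zero S =
    formula-step m zero S (forests-formula m) (λ _ → refl) refl
  forests-formula (suc m) (suc p) S =
    formula-step m (suc p) S (forests-formula m) (λ ())
      (trans (forests-formula (suc m) p S)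
             (cong (λ x → suc p * (suc m ^ length S * (x C suc m))) (sym (+-suc m (p + total S)))))

-- Counting the elements that satisfy a predicate.

record Counted {A : Set} (P : A → Set) (N : ℕ) : Set where
  field
    elem      : Fin N → A
    injective : ∀ {i j} → elem i ≡ elem j → i ≡ j
    sound     : ∀ i → P (elem i)
    complete  : ∀ {x} → P x → ∃ λ i → elem i ≡ x

open Counted

module _ {A : Set} where

  -- Enumerations list elements of A alone, so proofs of P are compared only here, where irrelevance
  -- settles it.
  Counted⇒↔ : ∀ {P : A → Set} {N} → Irrelevant P → Counted P N → Σ A P ↔ Fin N
  Counted⇒↔ {P} irr c = mk↔ₛ′
    (λ (x , Px) → proj₁ (complete c Px))
    (λ i → elem c i , sound c i)
    (λ i → injective c (proj₂ (complete c (sound c i))))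
    (λ (x , Px) → pair≡ (proj₂ (complete c Px)))
    where
    pair≡ : ∀ {x y} {Px : P x} {Py : P y} → x ≡ y → (x , Px) ≡ (y , Py)
    pair≡ refl = cong (_ ,_) (irr _ _)

  Counted-∅ : ∀ {P : A → Set} → (∀ {x} → ¬ P x) → Counted P 0
  Counted-∅ ¬P .elem ()
  Counted-∅ ¬P .injective {()}
  Counted-∅ ¬P .sound ()
  Counted-∅ ¬P .complete Px = ⊥-elim (¬P Px)

  Counted-singleton : ∀ {P : A → Set} {x} → P x → (∀ {y} → P y → x ≡ y) → Counted P 1
  Counted-singleton {x = x} Px unique .elem _ = x
  Counted-singleton Px unique .injective {zero} {zero} _ = refl
  Counted-singleton Px unique .sound _ = Px
  Counted-singleton Px unique .complete Py = zero , unique Py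

  Counted-⊎ : ∀ {P Q : A → Set} {M N} → (∀ {x} → P x → ¬ Q x) →
              Counted P M → Counted Q N → Counted (λ x → P x ⊎ Q x) (M + N)
  Counted-⊎ {P} {Q} {M} {N} disjoint c c′ = record
    { elem      = either ∘ splitAt M
    ; injective = λ {i} {j} eq → trans (sym (join-splitAt M N i))
                    (trans (cong (join M N) (either-injective (splitAt M i) (splitAt M j) eq))
                           (join-splitAt M N j))
    ; sound     = λ i → either-sound (splitAt M i)
    ; complete  = λ where
        (inj₁ Px) → let i , eq = complete c Px in
          join M N (inj₁ i) , trans (cong either (splitAt-join M N (inj₁ i))) eq
        (inj₂ Qx) → let i , eq = complete c′ Qx in
          join M N (inj₂ i) , trans (cong either (splitAt-join M N (inj₂ i))) eq
    }
    where
    either : Fin M ⊎ Fin N → A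
    either = [ elem c , elem c′ ]′

    either-sound : ∀ s → P (either s) ⊎ Q (either s)
    either-sound (inj₁ i) = inj₁ (sound c i)
    either-sound (inj₂ i) = inj₂ (sound c′ i)

    either-injective : ∀ s t → either s ≡ either t → s ≡ t
    either-injective (inj₁ i) (inj₁ j) eq = cong inj₁ (injective c eq)
    either-injective (inj₁ i) (inj₂ j) eq = ⊥-elim (disjoint (sound c i) (subst Q (sym eq) (sound c′ j)))
    either-injective (inj₂ i) (inj₁ j) eq = ⊥-elim (disjoint (sound c j) (subst Q eq (sound c′ i)))
    either-injective (inj₂ i) (inj₂ j) eq = cong inj₂ (injective c′ eq)

  -- The maps need to be inverse only on P and Q. This matters for attaching and detaching blocks,
  -- which are not inverse on arbitrary forests.
  Counted-map : ∀ {B : Set} {P : A → Set} {Q : B → Set} {N} (f : A → B) (g : B → A) →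
                (∀ {x} → P x → Q (f x) × g (f x) ≡ x) →
                (∀ {y} → Q y → P (g y) × f (g y) ≡ y) →
                Counted P N → Counted Q N
  Counted-map f g to from c = record
    { elem      = f ∘ elem c
    ; injective = λ {i} {j} eq → injective c
        (trans (sym (proj₂ (to (sound c i)))) (trans (cong g eq) (proj₂ (to (sound c j)))))
    ; sound     = λ i → proj₁ (to (sound c i))
    ; complete  = λ Qy → let Pgy , fgy = from Qy ; i , eq = complete c Pgy in
                         i , trans (cong f eq) fgy
    }

  Counted-resp : ∀ {P Q : A → Set} {N} → (∀ {x} → P x → Q x) → (∀ {x} → Q x → P x) →
                 Counted P N → Counted Q N
  Counted-resp P⇒Q Q⇒P = Counted-map id id (λ Px → P⇒Q Px , refl) (λ Qx → Q⇒P Qx , refl)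

-- Increasing lists as finite sets, and their splittings.

Increasing : List ℕ → Set
Increasing = AllPairs _<_

interleaving-All : ∀ {P : ℕ → Set} {a r S} → Interleaving a r S → All P S → All P a × All P r
interleaving-All []        []         = [] , []
interleaving-All (consˡ s) (Px ∷ PS) = let Pa , Pr = interleaving-All s PS in Px ∷ Pa , Pr
interleaving-All (consʳ s) (Px ∷ PS) = let Pa , Pr = interleaving-All s PS in Pa , Px ∷ Pr

interleaving-Increasing : ∀ {a r S} → Interleaving a r S → Increasing S → Increasing a × Increasing r
interleaving-Increasing []        []         = [] , []
interleaving-Increasing (consˡ s) (x<S ∷ S↑) =
  let a↑ , r↑ = interleaving-Increasing s S↑ in proj₁ (interleaving-All s x<S) ∷ a↑ , r↑
interleaving-Increasing (consʳ s) (x<S ∷ S↑) =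
  let a↑ , r↑ = interleaving-Increasing s S↑ in a↑ , proj₂ (interleaving-All s x<S) ∷ r↑

-- Follows the recursion of `splitSum`: the head x goes to one side or the other. As Q determines
-- `a`, no element is counted twice.
Counted-splits : ∀ {A : Set} {S} → Increasing S → (Q : List ℕ → List ℕ → A → Set) {N : List ℕ → List ℕ → ℕ} →
  (∀ {a r a′ r′ x} → Q a r x → Q a′ r′ x → a ≡ a′) →
  (∀ {a r} → Interleaving a r S → Counted (Q a r) (N a r)) →
  Counted (λ x → ∃₂ λ a r → Interleaving a r S × Q a r x) (splitSum S N)
Counted-splits [] Q det c = Counted-resp (λ q → [] , [] , [] , q) (λ where (_ , _ , [] , q) → q) (c [])
Counted-splits {S = x ∷ S} (x<S ∷ S↑) Q det c =
  Counted-resp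
    (λ where
      (inj₁ (a , r , s , q)) → x ∷ a , r , consˡ s , q
      (inj₂ (a , r , s , q)) → a , x ∷ r , consʳ s , q)
    (λ where
      (_ , _ , consˡ s , q) → inj₁ (_ , _ , s , q)
      (_ , _ , consʳ s , q) → inj₂ (_ , _ , s , q))
    (Counted-⊎ disjoint
      (Counted-splits S↑ (λ a r → Q (x ∷ a) r) (λ q q′ → ∷-injectiveʳ (det q q′)) (λ s → c (consˡ s)))
      (Counted-splits S↑ (λ a r → Q a (x ∷ r)) det (λ s → c (consʳ s))))
  where
  disjoint : ∀ {y} → (∃₂ λ a r → Interleaving a r S × Q (x ∷ a) r y) →
                     ¬ (∃₂ λ a r → Interleaving a r S × Q a (x ∷ r) y)
  disjoint (_ , _ , _ , q) (_ , _ , s , q′) with det q q′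
  -- The sublist drawn from S would begin with x, but all entries of S exceed x.
  ... | refl = <-irrefl refl (All.head (proj₁ (interleaving-All s x<S)))

-- Multiplicities of labels.

δ : ℕ → ℕ → ℕ
δ j x = if j ≡ᵇ x then 1 else 0

δ-refl : ∀ x → δ x x ≡ 1
δ-refl zero    = refl
δ-refl (suc x) = δ-refl x

δ-≢ : ∀ j x → j ≢ x → δ j x ≡ 0
δ-≢ zero    zero    ne = ⊥-elim (ne refl)
δ-≢ zero    (suc x) ne = refl
δ-≢ (suc j) zero    ne = refl
δ-≢ (suc j) (suc x) ne = δ-≢ j x (ne ∘ cong suc)

count-++ : ∀ j xs ys → count j (xs ++ ys) ≡ count j xs + count j ys
count-++ j []       ys = refl
count-++ j (x ∷ xs) ys = trans (cong (δ j x +_) (count-++ j xs ys)) (sym (+-assoc (δ j x) _ _))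

count-fresh : ∀ {j xs} → All (j ≢_) xs → count j xs ≡ 0
count-fresh []          = refl
count-fresh (ne ∷ rest) = cong₂ _+_ (δ-≢ _ _ ne) (count-fresh rest)

count-head : ∀ x xs → 1 ≤ count x (x ∷ xs)
count-head x xs = subst (λ c → 1 ≤ c + count x xs) (sym (δ-refl x)) (s≤s z≤n)

count-∈ : ∀ {j xs} → j ∈ xs → 1 ≤ count j xs
count-∈ {j} {_ ∷ xs} (here refl) = count-head j xs
count-∈ {j} {x ∷ _}  (there j∈)  = ≤-trans (count-∈ j∈) (m≤n+m _ (δ j x))

count-∈-Increasing : ∀ {j xs} → Increasing xs → j ∈ xs → count j xs ≡ 1
count-∈-Increasing {j} (j<xs ∷ _) (here refl) = cong₂ _+_ (δ-refl j) (count-fresh (All.map <⇒≢ j<xs))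
count-∈-Increasing {j} (x<xs ∷ xs↑) (there j∈) =
  cong₂ _+_ (δ-≢ j _ (≢-sym (<⇒≢ (All.lookup x<xs j∈)))) (count-∈-Increasing xs↑ j∈)

count-interleaving : ∀ j {a r S} → Interleaving a r S → count j S ≡ count j a + count j r
count-interleaving j []                   = refl
count-interleaving j {x ∷ _} (consˡ s) =
  trans (cong (δ j x +_) (count-interleaving j s)) (sym (+-assoc (δ j x) _ _))
count-interleaving j {a} {x ∷ _} (consʳ s) =
  trans (cong (δ j x +_) (count-interleaving j s)) (swap (δ j x) (count j a) _)
  where
  swap : ∀ x y z → x + (y + z) ≡ y + (x + z)
  swap = solve-∀

-- Recovers S - A from multiplicities alone, by comparing heads. A head of `a` below that of S would
-- be missing from S, equal heads are matched, and a smaller head of S does not occur in `a` and so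
-- goes to the complement.
complement : ∀ {a S} → Increasing a → Increasing S → (∀ j → count j a ≤ count j S) →
             ∃ λ r → Interleaving a r S
complement {[]} {[]} _ _ _ = [] , []
complement {x ∷ a} {[]} _ _ a≤S = contradiction (≤-trans (count-head x a) (a≤S x)) λ ()
complement {[]} {s ∷ S} _ (_ ∷ S↑) _ = let r , i = complement [] S↑ (λ _ → z≤n) in s ∷ r , consʳ i
complement {x ∷ a} {s ∷ S} xa↑@(x<a ∷ a↑) (s<S ∷ S↑) a≤S with <-cmp x s
... | tri< x<s _ _ = contradiction
  (subst (1 ≤_) (count-fresh (<⇒≢ x<s ∷ All.map (λ s<y → <⇒≢ (<-trans x<s s<y)) s<S))
         (≤-trans (count-head x a) (a≤S x)))
  λ ()
... | tri≈ _ refl _ = let r , i = complement a↑ S↑ (λ j → +-cancelˡ-≤ (δ j x) _ _ (a≤S j)) in r , consˡ i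
... | tri> _ _ s<x = let r , i = complement xa↑ S↑ a≤S′ in s ∷ r , consʳ i
  where
  s≢xa : All (s ≢_) (x ∷ a)
  s≢xa = <⇒≢ s<x ∷ All.map (λ x<y → <⇒≢ (<-trans s<x x<y)) x<a
  a≤S′ : ∀ j → count j (x ∷ a) ≤ count j S
  a≤S′ j with j ≟ s
  ... | yes refl = subst (_≤ count s S) (sym (count-fresh s≢xa)) z≤n
  ... | no j≢s   = subst (λ c → count j (x ∷ a) ≤ c + count j S) (δ-≢ j s j≢s) (a≤S j)

-- From Boolean tests to propositions, and cutting lists.

increasing⇒Increasing : ∀ xs → T (increasing xs) → Increasing xs
increasing⇒Increasing []           _ = []
increasing⇒Increasing (x ∷ [])     _ = [] ∷ []
increasing⇒Increasing (x ∷ y ∷ xs) t =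
  let x<ᵇy , t′ = Equivalence.to (T-∧ {x <ᵇ y}) t in
  cons (<ᵇ⇒< x y x<ᵇy) (increasing⇒Increasing (y ∷ xs) t′)
  where
  cons : ∀ {x y xs} → x < y → Increasing (y ∷ xs) → Increasing (x ∷ y ∷ xs)
  cons x<y ys↑@(y<xs ∷ _) = (x<y ∷ All.map (<-trans x<y) y<xs) ∷ ys↑

Increasing⇒increasing : ∀ {xs} → Increasing xs → T (increasing xs)
Increasing⇒increasing []                   = _
Increasing⇒increasing (_ ∷ [])             = _
Increasing⇒increasing {x ∷ y ∷ _} ((x<y ∷ _) ∷ ys↑@(_ ∷ _)) =
  Equivalence.from (T-∧ {x <ᵇ y}) (<⇒<ᵇ x<y , Increasing⇒increasing ys↑)

allB⇒All : ∀ {A : Set} {p : A → Bool} xs → T (allB p xs) → All (T ∘ p) xs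
allB⇒All         []       _ = []
allB⇒All {p = p} (x ∷ xs) t = let px , pxs = Equivalence.to (T-∧ {p x}) t in px ∷ allB⇒All xs pxs

All⇒allB : ∀ {A : Set} {p : A → Bool} {xs} → All (T ∘ p) xs → T (allB p xs)
All⇒allB         []         = _
All⇒allB {p = p} {x ∷ _} (px ∷ pxs) = Equivalence.from (T-∧ {p x}) (px , All⇒allB pxs)

take-length-++ : ∀ {A : Set} {l} (xs ys : List A) → length xs ≡ l → take l (xs ++ ys) ≡ xs
take-length-++ []       ys refl = refl
take-length-++ (x ∷ xs) ys refl = cong (x ∷_) (take-length-++ xs ys refl)

drop-length-++ : ∀ {A : Set} {l} (xs ys : List A) → length xs ≡ l → drop l (xs ++ ys) ≡ ys
drop-length-++ []       ys refl = refl
drop-length-++ (x ∷ xs) ys refl = drop-length-++ xs ys refl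

-- Forests as lists of rows of blocks.

Row : Set
Row = List Block

-- Roots carry no label: it is dictated by the place a root came from, so its row of blocks is all
-- that has to be kept.
Forest : Set
Forest = List Row

row : ETree → Row
row (enode _ bs) = bs

-- The grandchildren below a block, ready to become roots. The labels lost here are restored by
-- `graft`.
flatten : List OTree → Forest
flatten []                = []
flatten (onode _ es ∷ os) = map row es ++ flatten os

labelsF : Forest → List ℕ
labelsF []      = []
labelsF (r ∷ f) = labelsBs r ++ labelsF f

blocksF : Forest → ℕ
blocksF []      = 0
blocksF (r ∷ f) = length r + blocksBs r + blocksF f

trees : Block → List OTree
trees leafBlock     = []
trees (labBlock os) = os

-- An unlabeled leaf is coded by the empty set of labels, so that a single sum over A covers both
-- kinds of block. There is no clash, as `labBlock []` is not allowed.
block : List OTree → Block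
block []         = leafBlock
block os@(_ ∷ _) = labBlock os

trees-block : ∀ os → trees (block os) ≡ os
trees-block []      = refl
trees-block (_ ∷ _) = refl

labels-block : ∀ os → labelsB (block os) ≡ labelsOs os
labels-block []      = refl
labels-block (_ ∷ _) = refl

blocks-block : ∀ os → blocksB (block os) ≡ blocksOs os
blocks-block []      = refl
blocks-block (_ ∷ _) = refl

blocksF-++ : ∀ f g → blocksF (f ++ g) ≡ blocksF f + blocksF g
blocksF-++ []      g = refl
blocksF-++ (r ∷ f) g =
  trans (cong (length r + blocksBs r +_) (blocksF-++ f g)) (sym (+-assoc (length r + blocksBs r) _ _))

labelsF-++ : ∀ f g → labelsF (f ++ g) ≡ labelsF f ++ labelsF g
labelsF-++ []      g = refl
labelsF-++ (r ∷ f) g =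
  trans (cong (labelsBs r ++_) (labelsF-++ f g)) (sym (++-assoc (labelsBs r) _ _))

blocksEs-rows : ∀ es → blocksEs es ≡ blocksF (map row es)
blocksEs-rows []                = refl
blocksEs-rows (enode _ bs ∷ es) = cong (length bs + blocksBs bs +_) (blocksEs-rows es)

blocksOs-flatten : ∀ os → blocksOs os ≡ blocksF (flatten os)
blocksOs-flatten []                = refl
blocksOs-flatten (onode _ es ∷ os) =
  trans (cong₂ _+_ (blocksEs-rows es) (blocksOs-flatten os)) (sym (blocksF-++ (map row es) _))

FirstBlock : List ℕ → Forest → Set
FirstBlock a []            = ⊥
FirstBlock a ([] ∷ _)      = ⊥
FirstBlock a ((b ∷ _) ∷ _) = map olabel (trees b) ≡ a

FirstBlock-unique : ∀ {a a′} f → FirstBlock a f → FirstBlock a′ f → a ≡ a′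
FirstBlock-unique ((_ ∷ _) ∷ _) refl refl = refl

-- The empty forest is a default value: in a valid forest at least one root is left after the
-- grandchildren are taken off.
attachBlock : List OTree → Forest → Forest
attachBlock os []      = []
attachBlock os (r ∷ f) = (block os ∷ r) ∷ f

-- Undoes both moves of the recurrence, adding a leaf root and attaching a first block.
detach : Forest → Forest
detach []            = []
detach ([] ∷ f)      = f
detach ((b ∷ r) ∷ f) = flatten (trees b) ++ r ∷ f

-- Removing and attaching the first block.

module _ (n : ℕ) (k : Fin n → ℕ) where

  d : ℕ → ℕ
  d i = mult n k i ∸ 1

  size : List ℕ → ℕ
  size = total d

  -- Inverts `flatten` once the odd-level labels are known, because condition (iii) fixes how many
  -- children each vertex has and how they are labeled.
  graft : List ℕ → Forest → List OTree
  graft []      g = []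
  graft (i ∷ a) g = onode i (map (enode i) (take (d i) g)) ∷ graft a (drop (d i) g)

  Grafted : OTree → Set
  Grafted (onode i es) = length es ≡ d i × All (λ e → elabel e ≡ i) es

  attach : List ℕ → Forest → Forest
  attach a g = attachBlock (graft a g) (drop (size a) g)

  map-row-enode : ∀ i (rs : Forest) → map row (map (enode i) rs) ≡ rs
  map-row-enode i []       = refl
  map-row-enode i (r ∷ rs) = cong (r ∷_) (map-row-enode i rs)

  map-enode-row : ∀ {i es} → All (λ e → elabel e ≡ i) es → map (enode i) (map row es) ≡ es
  map-enode-row []                          = refl
  map-enode-row {es = enode _ _ ∷ _} (refl ∷ es) = cong (_ ∷_) (map-enode-row es)

  graft-labels : ∀ a g → map olabel (graft a g) ≡ a
  graft-labels []      g = refl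
  graft-labels (i ∷ a) g = cong (i ∷_) (graft-labels a (drop (d i) g))

  flatten-length : ∀ {os} → All Grafted os → length (flatten os) ≡ size (map olabel os)
  flatten-length []                                     = refl
  flatten-length {onode i es ∷ os} ((len , _) ∷ gs) =
    trans (length-++ (map row es)) (cong₂ _+_ (trans (length-map row es) len) (flatten-length gs))

  graft-flatten : ∀ {os} g → All Grafted os → graft (map olabel os) (flatten os ++ g) ≡ os
  graft-flatten g [] = refl
  graft-flatten {onode i es ∷ os} g ((len , lab) ∷ gs)
    rewrite ++-assoc (map row es) (flatten os) g
          | take-length-++ (map row es) (flatten os ++ g) (trans (length-map row es) len)
          | drop-length-++ (map row es) (flatten os ++ g) (trans (length-map row es) len)
    = cong₂ (λ x y → onode i x ∷ y) (map-enode-row lab) (graft-flatten g gs)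

  -- No bound on the length of `g` is required, since `take` and `drop` rejoin in any case; the
  -- bound matters only for `graft-Grafted`.
  flatten-graft : ∀ a g → flatten (graft a g) ++ drop (size a) g ≡ g
  flatten-graft []      g = refl
  flatten-graft (i ∷ a) g
    rewrite map-row-enode i (take (d i) g)
          | ++-assoc (take (d i) g) (flatten (graft a (drop (d i) g))) (drop (size (i ∷ a)) g)
          | sym (drop-drop (d i) (size a) g)
          | flatten-graft a (drop (d i) g)
    = take++drop≡id (d i) g

  graft-Grafted : ∀ a g → size a ≤ length g → All Grafted (graft a g)
  graft-Grafted []      g _   = []
  graft-Grafted (i ∷ a) g a≤g =
    (trans (length-map (enode i) (take (d i) g))
      (trans (length-take (d i) g) (m≤n⇒m⊓n≡m (m+n≤o⇒m≤o (d i) a≤g)))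
    , labelled (take (d i) g))
    ∷ graft-Grafted a (drop (d i) g)
        (subst (size a ≤_) (sym (length-drop (d i) g)) (m+n≤o⇒n≤o∸m (d i) a≤g))
    where
    m+n≤o⇒n≤o∸m : ∀ x {y z} → x + y ≤ z → y ≤ z ∸ x
    m+n≤o⇒n≤o∸m x {y} {z} le = subst (_≤ z ∸ x) (m+n∸m≡n x y) (∸-monoˡ-≤ x le)
    labelled : ∀ rs → All (λ e → elabel e ≡ i) (map (enode i) rs)
    labelled []       = []
    labelled (_ ∷ rs) = refl ∷ labelled rs

  OkRow : Row → Set
  OkRow r = T (okBs n k r)

  okEs⇒ : ∀ es → T (okEs n k es) → All OkRow (map row es)
  okEs⇒ []                _ = []
  okEs⇒ (enode _ bs ∷ es) t = let t₁ , t₂ = Equivalence.to (T-∧ {okBs n k bs}) t in t₁ ∷ okEs⇒ es t₂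

  okEs⇐ : ∀ es → All OkRow (map row es) → T (okEs n k es)
  okEs⇐ []                []       = _
  okEs⇐ (enode _ bs ∷ es) (r ∷ rs) = Equivalence.from (T-∧ {okBs n k bs}) (r , okEs⇐ es rs)

  -- Separates condition (iii) at the odd-level vertices from validity of the rows beneath, which is
  -- the part inherited by the smaller forest.
  okOs⇒ : ∀ os → T (okOs n k os) → All Grafted os × All OkRow (flatten os)
  okOs⇒ []                _ = [] , []
  okOs⇒ (onode i es ∷ os) t =
    let to , tos   = Equivalence.to (T-∧ {okO n k (onode i es)}) t
        len , t₁   = Equivalence.to (T-∧ {length es ≡ᵇ d i}) to
        lab , rows = Equivalence.to (T-∧ {allB (λ e → elabel e ≡ᵇ i) es}) t₁
        gs , okf   = okOs⇒ os tos
    in (≡ᵇ⇒≡ _ _ len , All.map (≡ᵇ⇒≡ _ _) (allB⇒All es lab)) ∷ gs , ++⁺ (okEs⇒ es rows) okf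

  okOs⇐ : ∀ os → All Grafted os → All OkRow (flatten os) → T (okOs n k os)
  okOs⇐ []                _                  _  = _
  okOs⇐ (onode i es ∷ os) ((len , lab) ∷ gs) ok =
    let oks , okf = ++⁻ (map row es) ok in
    Equivalence.from (T-∧ {okO n k (onode i es)})
      ( Equivalence.from (T-∧ {length es ≡ᵇ d i})
          ( ≡⇒≡ᵇ _ _ len
          , Equivalence.from (T-∧ {allB (λ e → elabel e ≡ᵇ i) es})
              (All⇒allB (All.map (≡⇒≡ᵇ _ _) lab) , okEs⇐ es oks))
      , okOs⇐ os gs okf)

  okB⇒ : ∀ b → T (okB n k b) →
         block (trees b) ≡ b × Increasing (map olabel (trees b)) × T (okOs n k (trees b))
  okB⇒ leafBlock              _ = refl , [] , _
  okB⇒ (labBlock os@(_ ∷ _)) t =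
    let inc , t′ = Equivalence.to (T-∧ {increasing (map olabel os)}) t in
    refl , increasing⇒Increasing _ inc , t′

  okB⇐ : ∀ os → Increasing (map olabel os) → T (okOs n k os) → T (okB n k (block os))
  okB⇐ []          _   _ = _
  okB⇐ os@(_ ∷ _) inc t =
    Equivalence.from (T-∧ {increasing (map olabel os)}) (Increasing⇒increasing inc , t)

  -- `d i` may be replaced by `d j` because `δ j i` vanishes unless i = j.
  weight-δ : ∀ j i c → δ j i + (d i * δ j i + c) ≡ suc (d j) * δ j i + c
  weight-δ j i c with j ≟ i
  ... | yes refl = sym (+-assoc (δ j j) (d j * δ j j) c)
  ... | no j≢i rewrite δ-≢ j i j≢i | *-zeroʳ (d i) | *-zeroʳ (d j) = refl

  count-labelsEs : ∀ j {i es} → All (λ e → elabel e ≡ i) es →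
                   count j (labelsEs es) ≡ length es * δ j i + count j (labelsF (map row es))
  count-labelsEs j [] = refl
  count-labelsEs j {i} {enode _ bs ∷ es} (refl ∷ lab)
    rewrite count-++ j (labelsBs bs) (labelsEs es) | count-++ j (labelsBs bs) (labelsF (map row es))
          | count-labelsEs j lab
    = regroup (δ j i) (count j (labelsBs bs)) (length es * δ j i) _
    where
    regroup : ∀ x b y c → x + (b + (y + c)) ≡ x + y + (b + c)
    regroup = solve-∀

  -- Flattening loses exactly each odd-level vertex i together with the labels of its `d i`
  -- children, that is `suc (d i)` copies of i.
  count-labelsOs : ∀ j {os} → All Grafted os →
    count j (labelsOs os) ≡ suc (d j) * count j (map olabel os) + count j (labelsF (flatten os))
  count-labelsOs j [] = sym (trans (+-identityʳ _) (*-zeroʳ (d j)))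
  count-labelsOs j {onode i es ∷ os} ((len , lab) ∷ gs)
    rewrite count-++ j (labelsEs es) (labelsOs os)
          | labelsF-++ (map row es) (flatten os)
          | count-++ j (labelsF (map row es)) (labelsF (flatten os))
          | count-labelsEs j lab | len | count-labelsOs j gs
    = begin
      δ j i + (d i * δ j i + c + (suc (d j) * l + c′))  ≡⟨ cong (δ j i +_) (+-assoc (d i * δ j i) c _) ⟩
      δ j i + (d i * δ j i + (c + (suc (d j) * l + c′))) ≡⟨ weight-δ j i _ ⟩
      suc (d j) * δ j i + (c + (suc (d j) * l + c′))     ≡⟨ regroup (suc (d j)) (δ j i) c l c′ ⟩
      suc (d j) * (δ j i + l) + (c + c′)                 ∎
    where
    c  = count j (labelsF (map row es))
    c′ = count j (labelsF (flatten os))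
    l  = count j (map olabel os)
    regroup : ∀ w x c l c′ → w * x + (c + (w * l + c′)) ≡ w * (x + l) + (c + c′)
    regroup = solve-∀

  -- S holds odd-level labels only, but labelsF lists all labels: each odd-level i
  -- brings its d i children, hence the factor suc (d j).
  record Valid (S : List ℕ) (p m : ℕ) (f : Forest) : Set where
    constructor valid-forest
    field
      len    : length f ≡ p
      ok     : All OkRow f
      blocks : blocksF f ≡ m
      labels : ∀ j → count j (labelsF f) ≡ suc (d j) * count j S

  close : ∀ {S p m f} → Valid S p m f → Valid S (suc p) m ([] ∷ f)
  close (valid-forest len ok blocks labels) = valid-forest (cong suc len) (_ ∷ ok) blocks labels

  unclose : ∀ {S p m f} → Valid S (suc p) m ([] ∷ f) → Valid S p m f
  unclose (valid-forest len (_ ∷ ok) blocks labels) = valid-forest (suc-injective len) ok blocks labels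

  module _ {os : List OTree} (r : Row) (f : Forest) (gs : All Grafted os) where

    attach-labels : ∀ j → count j (labelsF ((block os ∷ r) ∷ f))
                        ≡ suc (d j) * count j (map olabel os) + count j (labelsF (flatten os ++ r ∷ f))
    attach-labels j
      rewrite labels-block os | ++-assoc (labelsOs os) (labelsBs r) (labelsF f)
            | count-++ j (labelsOs os) (labelsF (r ∷ f))
            | labelsF-++ (flatten os) (r ∷ f) | count-++ j (labelsF (flatten os)) (labelsF (r ∷ f))
            | count-labelsOs j gs
      = +-assoc (suc (d j) * count j (map olabel os)) _ _

    attach-blocks : blocksF ((block os ∷ r) ∷ f) ≡ suc (blocksF (flatten os ++ r ∷ f))
    attach-blocks
      rewrite blocks-block os | blocksF-++ (flatten os) (r ∷ f) | blocksOs-flatten os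
      = cong suc (regroup (length r) (blocksF (flatten os)) (blocksBs r) (blocksF f))
      where
      regroup : ∀ x y z w → x + (y + z) + w ≡ y + (x + z + w)
      regroup = solve-∀

    detach-length : length (flatten os ++ r ∷ f) ≡ size (map olabel os) + suc (length f)
    detach-length = trans (length-++ (flatten os)) (cong (_+ suc (length f)) (flatten-length gs))

    detach-Valid : ∀ {S R p m} → Interleaving (map olabel os) R S →
      Valid S (suc p) (suc m) ((block os ∷ r) ∷ f) →
      Valid R (size (map olabel os) + suc p) m (flatten os ++ r ∷ f)
    detach-Valid {S} {R} s (valid-forest len (okbr ∷ okf) blocks labels) =
      let okb , okr = Equivalence.to (T-∧ {okB n k (block os)}) okbr
          _ , _ , oks = okB⇒ (block os) okb
          _ , okfl = okOs⇒ os (subst (T ∘ okOs n k) (trees-block os) oks)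
      in valid-forest
        (trans detach-length (cong (size (map olabel os) +_) len))
        (++⁺ okfl (okr ∷ okf))
        (suc-injective (trans (sym attach-blocks) blocks))
        -- The multiplicity in S is split between the block and R, and the block's share cancels.
        (λ j → +-cancelˡ-≡ (suc (d j) * count j (map olabel os)) _ _
          (trans (sym (attach-labels j)) (trans (labels j)
            (trans (cong (suc (d j) *_) (count-interleaving j s)) (*-distribˡ-+ (suc (d j)) (count j (map olabel os)) _)))))

    attach-Valid : ∀ {S R p m} → Interleaving (map olabel os) R S → Increasing (map olabel os) →
      Valid R (size (map olabel os) + suc p) m (flatten os ++ r ∷ f) →
      Valid S (suc p) (suc m) ((block os ∷ r) ∷ f)
    attach-Valid {S} {R} s inc (valid-forest len ok blocks labels) with ++⁻ (flatten os) ok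
    ... | okfl , okr ∷ okf = valid-forest
        (+-cancelˡ-≡ (size (map olabel os)) _ _ (trans (sym detach-length) len))
        (Equivalence.from (T-∧ {okB n k (block os)}) (okB⇐ os inc (okOs⇐ os gs okfl) , okr) ∷ okf)
        (trans attach-blocks (cong suc blocks))
        (λ j → trans (attach-labels j) (trans (cong (suc (d j) * count j (map olabel os) +_) (labels j))
          (trans (sym (*-distribˡ-+ (suc (d j)) (count j (map olabel os)) _)) (cong (suc (d j) *_) (sym (count-interleaving j s))))))

  attach-detach : ∀ {S R p m os} r f → Interleaving (map olabel os) R S → All Grafted os →
    Valid S (suc p) (suc m) ((block os ∷ r) ∷ f) →
    Valid R (size (map olabel os) + suc p) m (flatten os ++ r ∷ f)
      × attach (map olabel os) (flatten os ++ r ∷ f) ≡ (block os ∷ r) ∷ f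
  attach-detach {os = os} r f s gs v =
    detach-Valid r f gs s v ,
    cong₂ attachBlock (graft-flatten (r ∷ f) gs) (drop-length-++ (flatten os) (r ∷ f) (flatten-length gs))

  detach-attach : ∀ {S R p m os} rest → Interleaving (map olabel os) R S → Increasing S → All Grafted os →
    Valid R (size (map olabel os) + suc p) m (flatten os ++ rest) →
    (FirstBlock (map olabel os) (attachBlock os rest) × Valid S (suc p) (suc m) (attachBlock os rest))
      × detach (attachBlock os rest) ≡ flatten os ++ rest
  detach-attach {os = os} [] s S↑ gs v = contradiction
    (+-cancelˡ-≡ (size (map olabel os)) _ _
      (trans (sym (trans (length-++ (flatten os)) (cong (_+ 0) (flatten-length gs)))) (Valid.len v)))
    λ ()
  detach-attach {os = os} (r ∷ f) s S↑ gs v =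
    (cong (map olabel) (trees-block os) , attach-Valid r f gs s (proj₁ (interleaving-Increasing s S↑)) v) ,
    cong (λ os → flatten os ++ r ∷ f) (trees-block os)

  -- For a fixed label set A, removing the first block loses nothing: the list `a` tells how to
  -- regroup the first `size a` roots under it.
  firstBlock-split : ∀ {S R a p m N} → Increasing S → Interleaving a R S →
    Counted (Valid R (size a + suc p) m) N →
    Counted (λ f → FirstBlock a f × Valid S (suc p) (suc m) f) N
  firstBlock-split {S} {R} {a} {p} {m} S↑ s = Counted-map (attach a) detach to from
    where
    to : ∀ {g} → Valid R (size a + suc p) m g →
         (FirstBlock a (attach a g) × Valid S (suc p) (suc m) (attach a g)) × detach (attach a g) ≡ g
    -- Here `g` is rewritten as `flatten os ++ rest` with `os = graft a g`, the shape that
    -- `detach-attach` expects.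
    to {g} v = subst₂
      (λ b h → (FirstBlock b (attach a g) × Valid S (suc p) (suc m) (attach a g)) × detach (attach a g) ≡ h)
      (graft-labels a g) (flatten-graft a g)
      (detach-attach (drop (size a) g) (subst (λ b → Interleaving b R S) (sym (graft-labels a g)) s) S↑
        (graft-Grafted a g (subst (size a ≤_) (sym (Valid.len v)) (m≤m+n (size a) (suc p))))
        (subst₂ (λ b h → Valid R (size b + suc p) m h) (sym (graft-labels a g)) (sym (flatten-graft a g)) v))

    from : ∀ {f} → FirstBlock a f × Valid S (suc p) (suc m) f →
           Valid R (size a + suc p) m (detach f) × attach a (detach f) ≡ f
    from {(b ∷ r) ∷ f} (refl , v@(valid-forest _ (okbr ∷ _) _ _)) =
      let okb , _ = Equivalence.to (T-∧ {okB n k b}) okbr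
          eq , _ , oks = okB⇒ b okb
          v′ , eq′ = attach-detach r f s (proj₁ (okOs⇒ (trees b) oks))
                       (subst (λ b → Valid S (suc p) (suc m) ((b ∷ r) ∷ f)) (sym eq) v)
      in v′ , trans eq′ (cong (λ b → (b ∷ r) ∷ f) eq)

  -- Valid forests obey the recurrence.

  Closed : Forest → Set
  Closed ([] ∷ _) = ⊤
  Closed _        = ⊥

  closed-tail : ∀ {S p m N} → Counted (Valid S p m) N → Counted (λ f → Closed f × Valid S (suc p) m f) N
  closed-tail {S} {p} {m} = Counted-map ([] ∷_) detach (λ v → (_ , close v) , refl) from
    where
    from : ∀ {f} → Closed f × Valid S (suc p) m f → Valid S p m (detach f) × [] ∷ detach f ≡ f
    from {[] ∷ f} (_ , v) = unclose v , refl

  -- The first block contributes `suc (d j)` copies of each of its odd-level labels j to a forest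
  -- holding `suc (d j) * count j S`. Cancelling the factor shows that its label set lies in S, and
  -- `complement` supplies the rest.
  closed-or-block : ∀ {S p m} → Increasing S → ∀ f → Valid S (suc p) (suc m) f →
    Closed f ⊎ (∃₂ λ a r → Interleaving a r S × FirstBlock a f)
  closed-or-block S↑ []             v = contradiction (Valid.len v) λ ()
  closed-or-block S↑ ([] ∷ f)       v = inj₁ _
  closed-or-block {S} S↑ ((b ∷ r) ∷ f) v@(valid-forest _ (okbr ∷ _) _ labels) =
    let okb , _ = Equivalence.to (T-∧ {okB n k b}) okbr
        eq , inc , oks = okB⇒ b okb
        a≤S = λ j → *-cancelˡ-≤ (suc (d j)) (m+n≤o⇒m≤o _ (≤-reflexive
                (trans (sym (attach-labels r f (proj₁ (okOs⇒ (trees b) oks)) j))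
                  (trans (cong (λ b → count j (labelsF ((b ∷ r) ∷ f))) eq) (labels j)))))
        R , s = complement inc S↑ a≤S
    in inj₂ (_ , R , s , refl)

  -- Matches `forests` clause by clause. In the last clause the closed forests give the first
  -- summand, and the forests sorted by the labels of their first block give the sum over A.
  Counted-Valid : ∀ m p {S} → Increasing S → Counted (Valid S p m) (forests d m p S)
  Counted-Valid zero zero {[]} _ =
    Counted-singleton (valid-forest refl [] refl (λ j → sym (*-zeroʳ (d j)))) empty
    where
    empty : ∀ {f} → Valid [] 0 0 f → [] ≡ f
    empty {[]}    _ = refl
    empty {_ ∷ _} v = contradiction (Valid.len v) λ ()
  Counted-Valid zero zero {x ∷ S} _ = Counted-∅ none
    where
    none : ∀ {f} → ¬ Valid (x ∷ S) 0 0 f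
    none {_ ∷ _} v = contradiction (Valid.len v) λ ()
    -- The empty forest has no labels, but x is required at least once.
    none {[]}    v = <-irrefl (Valid.labels v x) (≤-trans (count-head x S) (m≤m+n _ _))
  Counted-Valid (suc m) zero _ = Counted-∅ none
    where
    none : ∀ {S f} → ¬ Valid S 0 (suc m) f
    none {f = _ ∷ _} v = contradiction (Valid.len v) λ ()
    none {f = []}    v = contradiction (Valid.blocks v) λ ()
  Counted-Valid zero (suc p) {S} S↑ =
    Counted-resp proj₂ (λ {f} v → closed f v , v) (closed-tail (Counted-Valid zero p S↑))
    where
    closed : ∀ f → Valid S (suc p) 0 f → Closed f
    closed []            v = contradiction (Valid.len v) λ ()
    closed ([] ∷ f)      v = _
    closed ((_ ∷ _) ∷ f) v = contradiction (Valid.blocks v) λ ()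
  Counted-Valid (suc m) (suc p) {S} S↑ =
    Counted-resp
      (λ where
        (inj₁ (_ , v))             → v
        (inj₂ (_ , _ , _ , _ , v)) → v)
      (λ {f} v → Sum.map (_, v) (λ (a , r , s , fb) → a , r , s , fb , v) (closed-or-block S↑ f v))
      (Counted-⊎ disjoint
        (closed-tail (Counted-Valid (suc m) p S↑))
        (Counted-splits S↑ (λ a r f → FirstBlock a f × Valid S (suc p) (suc m) f)
          (λ {_} {_} {_} {_} {f} (fb , _) (fb′ , _) → FirstBlock-unique f fb fb′)
          (λ {a} {r} s → firstBlock-split S↑ s
            (Counted-Valid m (size a + suc p) (proj₂ (interleaving-Increasing s S↑))))))
    where
    disjoint : ∀ {f} → Closed f × Valid S (suc p) (suc m) f →
               ¬ (∃₂ λ a r → Interleaving a r S × FirstBlock a f × Valid S (suc p) (suc m) f)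
    disjoint {[] ∷ _} _ (_ , _ , _ , () , _)

  -- Trees as one-root forests with label set {1..n}.

  labelSet : List ℕ
  labelSet = tabulate {n = n} (suc ∘ toℕ)

  labelSet-Increasing : Increasing labelSet
  labelSet-Increasing = tabulate⁺-< s≤s

  mult-suc : ∀ i → mult n k (suc (toℕ i)) ≡ k i
  mult-suc i with toℕ i <? n
  ... | yes i<n = cong k (fromℕ<-toℕ i i<n)
  ... | no i≮n  = contradiction (toℕ<n i) i≮n

  count-labelSet-> : ∀ {j} → n < j → count j labelSet ≡ 0
  count-labelSet-> {j} n<j = count-fresh (All.tabulate⁺ λ i eq → <-irrefl (sym eq) (≤-<-trans (toℕ<n i) n<j))

  module _ (k≥1 : ∀ i → 1 ≤ k i) where

    -- The term `δ j 0` is the root's label. For j ≥ 1 the hypothesis k ≥ 1 makes `suc (d j)` the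
    -- true multiplicity in spite of truncated subtraction.
    mult-labelSet : ∀ {j} → j ≤ n → δ j 0 + suc (d j) * count j labelSet ≡ mult n k j
    mult-labelSet {zero} _ = cong (λ c → 1 + 1 * c) (count-fresh (All.tabulate⁺ {n = n} {f = suc ∘ toℕ} λ i ()))
    mult-labelSet {suc j} j<n
      rewrite sym (toℕ-fromℕ< j<n)
            | count-∈-Increasing labelSet-Increasing (∈-tabulate⁺ {f = suc ∘ toℕ} (fromℕ< j<n))
            | mult-suc (fromℕ< j<n)
      = trans (*-identityʳ _) (m+[n∸m]≡n (k≥1 (fromℕ< j<n)))

    -- The test compares multiplicities only for j ≤ n. For larger j both sides vanish, by the bound
    -- on the labels and by the choice of `labelSet`.
    labelsOK⇒ : ∀ ls → T (labelsOK n k (0 ∷ ls)) → ∀ j → count j ls ≡ suc (d j) * count j labelSet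
    labelsOK⇒ ls t j with Equivalence.to (T-∧ {allB (λ l → l ≤ᵇ n) (0 ∷ ls)}) t | j ≤? n
    ... | _ , t₂ | yes j≤n = +-cancelˡ-≡ (δ j 0) _ _
      (trans (≡ᵇ⇒≡ _ _ (All.lookup (allB⇒All (upTo (suc n)) t₂) (∈-upTo⁺ (s≤s j≤n)))) (sym (mult-labelSet j≤n)))
    ... | t₁ , _ | no j≰n = trans
      (count-fresh (All.map (λ l≤n eq → j≰n (subst (_≤ n) (sym eq) (≤ᵇ⇒≤ _ _ l≤n))) (All.tail (allB⇒All (0 ∷ ls) t₁))))
      (sym (trans (cong (suc (d j) *_) (count-labelSet-> (≰⇒> j≰n))) (*-zeroʳ (d j))))

    labelsOK⇐ : ∀ ls → (∀ j → count j ls ≡ suc (d j) * count j labelSet) → T (labelsOK n k (0 ∷ ls))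
    labelsOK⇐ ls counts = Equivalence.from (T-∧ {allB (λ l → l ≤ᵇ n) (0 ∷ ls)})
      ( All⇒allB {xs = 0 ∷ ls} (_ ∷ All.tabulate λ {l} l∈ → ≤⇒≤ᵇ (bounded l∈))
      , All⇒allB (All.tabulate λ {j} j∈ → ≡⇒≡ᵇ _ _
          (trans (cong (δ j 0 +_) (counts j)) (mult-labelSet (s≤s⁻¹ (∈-upTo⁻ j∈))))))
      where
      bounded : ∀ {l} → l ∈ ls → l ≤ n
      bounded {l} l∈ = ≮⇒≥ λ n<l → contradiction
        (subst (1 ≤_) (trans (counts l) (trans (cong (suc (d l) *_) (count-labelSet-> n<l)) (*-zeroʳ (d l)))) (count-∈ l∈))
        λ ()

    -- The value at `[]` is a default; the forests in question have exactly one root.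
    root : Forest → ETree
    root []      = enode 0 []
    root (r ∷ _) = enode 0 r

    Counted-BT : ∀ m → Counted (T ∘ valid n k m) (forests d m 1 labelSet)
    Counted-BT m = Counted-map root (λ t → row t ∷ []) to from (Counted-Valid m 1 labelSet-Increasing)
      where
      to : ∀ {f} → Valid labelSet 1 m f → T (valid n k m (root f)) × row (root f) ∷ [] ≡ f
      to {[]}    (valid-forest () _ _ _)
      to {r ∷ _ ∷ _} (valid-forest () _ _ _)
      to {r ∷ []} (valid-forest _ (ok ∷ _) blocks labels) =
        Equivalence.from (T-∧ {okBs n k r})
          ( ok
          , Equivalence.from (T-∧ {labelsOK n k (0 ∷ labelsBs r)})
              ( labelsOK⇐ (labelsBs r) (subst (λ ls → ∀ j → count j ls ≡ suc (d j) * count j labelSet) (++-identityʳ (labelsBs r)) labels)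
              , ≡⇒≡ᵇ _ m (trans (sym (+-identityʳ _)) blocks)))
        , refl

      from : ∀ {t} → T (valid n k m t) → Valid labelSet 1 m (row t ∷ []) × root (row t ∷ []) ≡ t
      from {enode l r} t with Equivalence.to (T-∧ {l ≡ᵇ 0}) t
      ... | l≡0 , t₁ with ≡ᵇ⇒≡ l 0 l≡0 | Equivalence.to (T-∧ {okBs n k r}) t₁
      ... | refl | ok , t₂ =
        let labs , blk = Equivalence.to (T-∧ {labelsOK n k (0 ∷ labelsBs r)}) t₂ in
        valid-forest refl (ok ∷ [])
          (trans (+-identityʳ _) (≡ᵇ⇒≡ _ m blk))
          (subst (λ ls → ∀ j → count j ls ≡ suc (d j) * count j labelSet) (sym (++-identityʳ (labelsBs r))) (labelsOK⇒ (labelsBs r) labs))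
        , refl

    -- Each k i exceeds its d by one, and there are n of them. Thus K - n is d(S), and for one root
    -- q is K - n + 1.
    Ksum-labelSet : Ksum n k ≡ size labelSet + n
    Ksum-labelSet = trans (sum-suc k (d ∘ suc ∘ toℕ) k≡)
      (cong (λ xs → sum xs + n) (sym (map-tabulate {n = n} (suc ∘ toℕ) d)))
      where
      k≡ : ∀ i → k i ≡ suc (d (suc (toℕ i)))
      k≡ i = trans (sym (m+[n∸m]≡n (k≥1 i))) (cong (λ x → suc (x ∸ 1)) (sym (mult-suc i)))
      sum-suc : ∀ {n} (g h : Fin n → ℕ) → (∀ i → g i ≡ suc (h i)) → sum (tabulate g) ≡ sum (tabulate h) + n
      sum-suc {zero}  g h eq = refl
      sum-suc {suc n} g h eq = trans (cong₂ _+_ (eq zero) (sum-suc (g ∘ suc) (h ∘ suc) (eq ∘ suc)))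
        (regroup (h zero) (sum (tabulate (h ∘ suc))) n)
        where
        regroup : ∀ x y n → suc x + (y + n) ≡ x + y + suc n
        regroup = solve-∀

theorem2p3 : (n : ℕ) → 1 ≤ n → (k : Fin n → ℕ) → (∀ i → 1 ≤ k i) → (m : ℕ) →
    Σ[ N ∈ ℕ ] ((BT n k m ↔ Fin N) ×
    (N * (Ksum n k ∸ n + 1) ≡ m ^ n * ((Ksum n k ∸ n + m) C m)))
theorem2p3 n _ k k≥1 m = N , Counted⇒↔ T-irrelevant (Counted-BT n k k≥1 m) , (begin
    N * (Ksum n k ∸ n + 1)                              ≡⟨ cong (λ x → N * (x + 1)) K∸n ⟩
    N * (D + 1)                                         ≡⟨ cong (N *_) (+-comm D 1) ⟩
    -- The closed form at p = 0, where q = 1 + D and q - 1 = D.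
    N * (1 + D)                                         ≡⟨ forests-formula (d n k) m 0 (labelSet n k) ⟩
    1 * (m ^ length (labelSet n k) * ((m + D) C m))     ≡⟨ *-identityˡ _ ⟩
    m ^ length (labelSet n k) * ((m + D) C m)
      ≡⟨ cong₂ (λ l e → m ^ l * (e C m)) (length-tabulate {n = n} (suc ∘ toℕ)) (+-comm m D) ⟩
    m ^ n * ((D + m) C m)                               ≡⟨ cong (λ x → m ^ n * ((x + m) C m)) K∸n ⟨
    m ^ n * ((Ksum n k ∸ n + m) C m)                    ∎)
  where
  N = forests (d n k) m 1 (labelSet n k)
  D = size n k (labelSet n k)
  K∸n : Ksum n k ∸ n ≡ D
  K∸n = trans (cong (_∸ n) (Ksum-labelSet n k k≥1)) (m+n∸n≡m D n)
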